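{- Let $n\ge 3$. Consider the board with two bounded cells formed by a cycle graph $C_n$ embedded in the plane together with one additional vertex $a$ inside the cycle that is joined by edges to exactly two adjacent vertices $b$ and $c$ of the cycle (and to no other vertices); the cells are the triangle $abc$ and a cell with $n+1$ boundary edges. In the Game of Cycles on this board, if $n$ is odd then Player~1 has a winning strategy, and if $n$ is even then Player~2 has a winning strategy.
   Context: The Game of Cycles. A board is a simple connected planar graph embedded in the plane, together with its bounded cells. Two players alternate turns; on a turn a player marks one unmarked edge with an arrow pointing along the edge in one of its two directions. Each edge receives at most one arrow, and arrows have the same effect regardless of who placed them. Moves must obey the sink-source rule: no move may create a sink (a vertex all of whose incident edges are marked with arrows pointing toward it) or a source (a vertex all of whose incident edges are marked with arrows pointing away from it). A player who has a legal move must make one. A cycle cell is a bounded cell all of whose boundary edges are marked with arrows all cycling in the same direction around that cell. The first player to create a cycle cell wins; if play ends (no legal move remains) without a cycle cell, the player who made the last move wins. A winning strategy guarantees a win regardless of the opponent's moves. -}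

module Defs where

open import Data.Empty using (⊥)
open import Data.Fin.Base using (Fin; zero; suc; toℕ; fromℕ; inject₁)
open import Data.Fin.Induction using (<-weakInduction)
open import Data.Fin.Properties using (toℕ-fromℕ; toℕ-inject₁)
open import Data.List.Base using (List; []; _∷_; _∷ʳ_; zip; length; tabulate; allFin)
open import Data.List.Membership.Propositional using (_∈_; _∉_)
open import Data.List.Properties using (length-tabulate)
open import Data.List.Relation.Unary.All using (All; []; _∷_)
open import Data.List.Relation.Unary.Any using (Any)
open import Data.Nat.Base using (ℕ; zero; suc; _≤_; z≤n; s≤s)
open import Data.Nat.Properties using (1+n≢n; m≤n⇒m≤1+n; ≤-refl; ≤-reflexive; ≤-trans)
open import Data.Product.Base using (_×_; _,_; ∃; uncurry; swap)
open import Data.Sum.Base using (_⊎_; inj₁; inj₂)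
import Data.Sum.Base as Sum
open import Function.Base using (_∘_)
open import Level using (0ℓ)
open import Relation.Binary.Construct.Closure.ReflexiveTransitive
  using (Star; ε; _◅_; _◅◅_; reverse)
open import Relation.Binary.Core using (Rel)
open import Relation.Binary.Definitions using (Symmetric)
open import Relation.Binary.PropositionalEquality
  using (_≡_; refl; sym; cong)
open import Relation.Nullary.Negation using (¬_)

-- The steps of the closed walk x₀ x₁ … xₖ x₀ encoded by the list x₀ … xₖ.
closedWalk : {A : Set} → List A → List (A × A)
closedWalk []       = []
closedWalk (x ∷ xs) = zip (x ∷ xs) (xs ∷ʳ x)

-- A finite simple connected graph with its bounded cells.  The plane
-- embedding affects play only through the bounded cells, so it is recorded
-- by listing, for each of them, the vertices met in going once around its
-- boundary (in either direction).
record Board : Set₁ where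
  field
    order     : ℕ
    Adj       : Rel (Fin order) 0ℓ
    adj-sym   : Symmetric Adj
    adj-irr   : ∀ v → ¬ Adj v v
    connected : ∀ u v → Star Adj u v
    cells     : List (List (Fin order))
    cells-ok  : All (λ κ → 3 ≤ length κ × All (uncurry Adj) (closedWalk κ)) cells

  Vertex : Set
  Vertex = Fin order

data Player : Set where
  player1 player2 : Player

opponent : Player → Player
opponent player1 = player2
opponent player2 = player1

module Game (B : Board) where
  open Board B

  -- (u , v) marks the edge uv with an arrow from u to v.
  Arrow : Set
  Arrow = Vertex × Vertex

  -- The arrows placed so far, most recent first; thus a position also
  -- records the history of the play.
  Position : Set
  Position = List Arrow

  toMove : Position → Player
  toMove []      = player1
  toMove (_ ∷ p) = opponent (toMove p)

  Sink Source : Position → Vertex → Set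
  Sink   p v = ∀ u → Adj u v → (u , v) ∈ p
  Source p v = ∀ u → Adj v u → (v , u) ∈ p

  -- By connectedness a board with an edge has no isolated vertex, so no
  -- vertex is a sink or a source at the start; hence no move creates one
  -- exactly when none is present after any move.
  Legal : Position → Arrow → Set
  Legal p (u , v) =
    Adj u v × (u , v) ∉ p × (v , u) ∉ p ×
    (∀ w → ¬ Sink ((u , v) ∷ p) w × ¬ Source ((u , v) ∷ p) w)

  CycleCell : Position → List Vertex → Set
  CycleCell p κ =
    All (_∈ p) (closedWalk κ) ⊎ All (λ e → swap e ∈ p) (closedWalk κ)

  HasCycleCell : Position → Set
  HasCycleCell p = Any (CycleCell p) cells

  NoLegalMove : Position → Set
  NoLegalMove p = ∀ m → ¬ Legal p m

  Over : Position → Set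
  Over p = HasCycleCell p ⊎ NoLegalMove p

  -- In m ∷ p the last move m was made by toMove p.
  data WonBy (P : Player) : Position → Set where
    by-cycle     : ∀ {m p} → HasCycleCell (m ∷ p) →
                   toMove p ≡ P → WonBy P (m ∷ p)
    by-last-move : ∀ {m p} → ¬ HasCycleCell (m ∷ p) → NoLegalMove (m ∷ p) →
                   toMove p ≡ P → WonBy P (m ∷ p)

  Strategy : Set
  Strategy = Position → Arrow

  -- The positions (with history) that can arise when P plays by σ and the
  -- opponent plays arbitrary legal moves.
  data Reachable (P : Player) (σ : Strategy) : Position → Set where
    start : Reachable P σ []
    move  : ∀ {m p} → Reachable P σ p → ¬ HasCycleCell p → Legal p m →
            (toMove p ≡ P → m ≡ σ p) → Reachable P σ (m ∷ p)

  -- Every move marks a new edge, so every play ends and winning all the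
  -- plays that are over is winning against every opponent.  The first
  -- component stops σ from stalling a play with an illegal move.
  Winning : Player → Strategy → Set
  Winning P σ = ∀ p → Reachable P σ p →
    (¬ Over p → toMove p ≡ P → Legal p (σ p)) × (Over p → WonBy P p)

  HasWinningStrategy : Player → Set
  HasWinningStrategy P = ∃ (Winning P)

open Game public using (HasWinningStrategy)

CycleNext : ∀ {n} → Rel (Fin n) 0ℓ
CycleNext {n} i j =
  suc (toℕ i) ≡ toℕ j ⊎ (suc (toℕ i) ≡ n × toℕ j ≡ 0)

CycleAdj : ∀ {n} → Rel (Fin n) 0ℓ
CycleAdj i j = CycleNext i j ⊎ CycleNext j i

-- n = suc m; the inner vertex a is zero, and suc i is the vertex i of Cₙ.
-- The adjacent cycle vertices b and c are the first and the last one.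
module TwoCell (m : ℕ) where

  b c : Fin (suc m)
  b = zero
  c = fromℕ m

  Adj : Rel (Fin (suc (suc m))) 0ℓ
  Adj zero    zero    = ⊥
  Adj zero    (suc j) = j ≡ b ⊎ j ≡ c
  Adj (suc i) zero    = i ≡ b ⊎ i ≡ c
  Adj (suc i) (suc j) = CycleAdj i j

  triangle : List (Fin (suc (suc m)))
  triangle = zero ∷ suc b ∷ suc c ∷ []

  -- From a to b, along the cycle from b to c avoiding the edge bc, and back
  -- to a: with the labelling above, all the vertices in order.
  longCell : List (Fin (suc (suc m)))
  longCell = allFin (suc (suc m))

  adj-sym : Symmetric Adj
  adj-sym {zero}  {suc j} e = e
  adj-sym {suc i} {zero}  e = e
  adj-sym {suc i} {suc j} e = Sum.swap e

  next-irr : 3 ≤ suc m → (i : Fin (suc m)) → ¬ CycleNext i i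
  next-irr _              i       (inj₁ e)       = 1+n≢n e
  next-irr (s≤s (s≤s _))  zero    (inj₂ (() , _))
  next-irr _              (suc i) (inj₂ (_ , ()))

  adj-irr : 3 ≤ suc m → ∀ v → ¬ Adj v v
  adj-irr 3≤n (suc i) (inj₁ e) = next-irr 3≤n i e
  adj-irr 3≤n (suc i) (inj₂ e) = next-irr 3≤n i e

  adj-step : (i : Fin (suc m)) → Adj (inject₁ i) (suc i)
  adj-step zero    = inj₁ refl
  adj-step (suc j) = inj₁ (inj₁ (cong suc (toℕ-inject₁ j)))

  connected : ∀ u v → Star Adj u v
  connected u v = reverse adj-sym (fromA u) ◅◅ fromA v
    where
    fromA : ∀ w → Star Adj zero w
    fromA = <-weakInduction (Star Adj zero) ε
              (λ i walk → walk ◅◅ (adj-step i ◅ ε))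

  walk-tabulate : ∀ {A : Set} {R : Rel A 0ℓ} {z : A} k (f : Fin (suc k) → A) →
                  (∀ i → R (f (inject₁ i)) (f (suc i))) → R (f (fromℕ k)) z →
                  All (uncurry R) (zip (tabulate f) (tabulate (f ∘ suc) ∷ʳ z))
  walk-tabulate zero    f step last = last ∷ []
  walk-tabulate (suc k) f step last =
    step zero ∷ walk-tabulate k (f ∘ suc) (step ∘ suc) last

  cells-ok : 3 ≤ suc m →
             All (λ κ → 3 ≤ length κ × All (uncurry Adj) (closedWalk κ))
                 (triangle ∷ longCell ∷ [])
  cells-ok 3≤n =
    (≤-refl , inj₁ refl ∷ inj₂ (inj₂ (cong suc (toℕ-fromℕ m) , refl))
              ∷ inj₂ refl ∷ []) ∷
    ( ≤-trans (m≤n⇒m≤1+n 3≤n)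
              (≤-reflexive (sym (length-tabulate {n = suc (suc m)} (λ i → i))))
    , walk-tabulate (suc m) (λ i → i) adj-step (inj₂ refl)) ∷
    []

twoCellBoard : ∀ n → 3 ≤ n → Board
twoCellBoard (suc m) 3≤n = record
  { order     = suc (suc m)
  ; Adj       = Adj
  ; adj-sym   = λ {u} {v} → adj-sym {u} {v}
  ; adj-irr   = adj-irr 3≤n
  ; connected = connected
  ; cells     = triangle ∷ longCell ∷ []
  ; cells-ok  = cells-ok 3≤n
  }
  where open TwoCell m

{-# OPTIONS --safe #-}

-- Let W be the player who would make the (n + 2)-nd move.  Call a position
-- decided when bc is marked, say b → c, and b → a or a → c is marked too.  The
-- triangle is then dead, and W wins however the play goes on.  Indeed the outer
-- path and the path b a c form a cycle with n + 1 edges on which, by the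
-- sink-source rule, adjacent marked edges agree in direction, while in a stuck
-- position both neighbours of an unmarked edge are marked, in opposite
-- directions.  Hence an even number of edges is unmarked, and W moved last;
-- the long cell, too, can only be completed by move n + 2.
--
-- To reach a decided position, W opens with bc when n is odd.  When n is even, W
-- answers bc by b → a (for b → c) and answers an edge at a by the orientation of
-- bc that decides the position; any other arrow is answered by bc, pointing
-- against it along the cycle b … c.  If the opponent then marks an edge at a,
-- either the position is decided or W completes the triangle; otherwise one of
-- b → a and a → c is legal and W plays it.
module Submission where

open import Defs
open import Algebra.Bundles using (CommutativeMonoid; module CommutativeRing)
import Algebra.Properties.CommutativeMonoid.Sum as Sum
open import Data.Bool.Base using (Bool; true; false; not; _∧_; _∨_; _xor_)
open import Data.Bool.Properties
  using (xor-∧-commutativeRing; xor-comm; xor-same; xor-identityʳ;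
         not-distribˡ-xor; not-involutive)
open import Data.Empty using (⊥)
open import Data.Fin.Base using (Fin; zero; suc; toℕ; fromℕ; inject₁; punchIn)
open import Data.Fin.Properties
  using (_≟_; all?; any?; toℕ-injective; toℕ-inject₁; toℕ-fromℕ; toℕ<n;
         punchInᵢ≢i; suc-injective)
open import Data.Fin.Relation.Unary.Top
  using (view; ‵fromℕ; ‵inj₁; view-fromℕ; view-inject₁)
open import Data.List.Base using ([]; _∷_; _∷ʳ_; zip; tabulate)
import Data.List.Membership.DecPropositional as DecMembership
open import Data.List.Membership.Propositional using (_∈_; _∉_)
open import Data.List.Relation.Unary.All as All using (All; []; _∷_)
open import Data.List.Relation.Unary.Any as Any using (here; there)
open import Data.Maybe.Base using (Maybe; just; nothing; maybe′; _>>=_)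
open import Data.Nat.Base using (ℕ; zero; suc; _≤_; s≤s; _*_; _+_)
open import Data.Nat.Divisibility using (_∣_; divides; ∣m∣n⇒∣m+n; ∣-refl)
import Data.Nat.Properties as ℕ
open import Data.Product.Base using (_×_; _,_; ∃; proj₁; proj₂; swap; uncurry)
open import Data.Product.Properties using (≡-dec)
open import Data.Sum.Base using (_⊎_; inj₁; inj₂)
open import Function.Base using (_∘_)
open import Relation.Binary.Definitions using (Decidable; DecidableEquality)
open import Relation.Binary.PropositionalEquality
  using (_≡_; _≢_; refl; sym; trans; cong; cong₂; subst; module ≡-Reasoning)
open import Relation.Nullary.Decidable
  using (Dec; yes; no; does; ¬?; map′; _×-dec_; _⊎-dec_; _→-dec_; dec-true;
         dec-false)
open import Relation.Nullary.Negation using (¬_; contradiction)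

-- Parity as a Boolean, and finite sums modulo 2.

xorMonoid : CommutativeMonoid _ _
xorMonoid = CommutativeRing.+-commutativeMonoid xor-∧-commutativeRing

open Sum xorMonoid
  using (sum; sum-remove; sum-cong-≗; ∑-distrib-+; sum-init-last)

odd : ℕ → Bool
odd zero    = false
odd (suc n) = not (odd n)

odd-2* : ∀ q → odd (q * 2) ≡ false
odd-2* zero = refl
odd-2* (suc q) rewrite odd-2* q = refl

2∣⇒even : ∀ {n} → 2 ∣ n → odd n ≡ false
2∣⇒even (divides q refl) = odd-2* q

even⇒2∣ : ∀ n → odd n ≡ false → 2 ∣ n
even⇒2∣ zero eq = divides 0 refl
even⇒2∣ (suc (suc n)) eq with odd n in e
... | false = ∣m∣n⇒∣m+n ∣-refl (even⇒2∣ n e)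

sum-true : ∀ n → sum {n} (λ _ → true) ≡ odd n
sum-true zero    = refl
sum-true (suc n) = cong not (sum-true n)

sum-false : ∀ n → sum {n} (λ _ → false) ≡ false
sum-false zero    = refl
sum-false (suc n) = sum-false n

-- Removing the summand at `i` from both sums leaves equal remainders. A single move changes the
-- count of unmarked edges in this way.
sum-toggle : ∀ {n} {f g : Fin (suc n) → Bool} i → f i ≡ not (g i) →
             (∀ j → j ≢ i → f j ≡ g j) → sum f ≡ not (sum g)
sum-toggle {f = f} {g} i fi fj = begin
  sum f                                   ≡⟨ sum-remove f ⟩
  f i xor sum (λ j → f (punchIn i j))     ≡⟨ cong₂ _xor_ fi (sum-cong-≗ λ j → fj _ (punchInᵢ≢i i j)) ⟩
  not (g i) xor sum (λ j → g (punchIn i j)) ≡⟨ not-distribˡ-xor (g i) _ ⟨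
  not (g i xor sum (λ j → g (punchIn i j))) ≡⟨ cong not (sum-remove g) ⟨
  not (sum g)                             ∎
  where open ≡-Reasoning

-- The cyclic successor on `Fin`, which walks around the long cell.

next : ∀ {n} → Fin (suc n) → Fin (suc n)
next i with view i
... | ‵fromℕ         = zero
... | ‵inj₁ {i = j} _ = suc j

next-last : ∀ n → next (fromℕ n) ≡ zero
next-last n rewrite view-fromℕ n = refl

next-inject₁ : ∀ {n} (i : Fin n) → next (inject₁ i) ≡ suc i
next-inject₁ i rewrite view-inject₁ i = refl

next-step : ∀ {n} {i j : Fin (suc n)} → suc (toℕ i) ≡ toℕ j → next i ≡ j
next-step {n} {i} {j} eq with view i
... | ‵fromℕ = contradiction (trans (cong suc (sym (toℕ-fromℕ n))) eq) (ℕ.<⇒≢ (toℕ<n j) ∘ sym)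
... | ‵inj₁ {i = i′} _ = toℕ-injective (trans (cong suc (sym (toℕ-inject₁ i′))) eq)

next-injective : ∀ {n} {i j : Fin (suc n)} → next i ≡ next j → i ≡ j
next-injective {i = i} {j} eq with view i | view j
... | ‵fromℕ  | ‵fromℕ  = refl
... | ‵inj₁ _ | ‵inj₁ _ = cong inject₁ (suc-injective eq)
next-injective () | ‵fromℕ | ‵inj₁ _
next-injective () | ‵inj₁ _ | ‵fromℕ

next-irreflexive : ∀ {n} {i : Fin (suc (suc n))} → next i ≢ i
next-irreflexive {i = i} eq with view i
next-irreflexive () | ‵fromℕ
... | ‵inj₁ {i = j} _ = ℕ.1+n≢n (trans (cong toℕ eq) (toℕ-inject₁ j))

next²-irreflexive : ∀ {n} {i : Fin (suc (suc (suc n)))} → next (next i) ≢ i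
next²-irreflexive {i = i} eq with view i
next²-irreflexive () | ‵fromℕ
... | ‵inj₁ {i = j} _ with view j
next²-irreflexive () | ‵inj₁ _ | ‵fromℕ
... | ‵inj₁ {i = j′} _ = ℕ.<⇒≢ (ℕ.m<n⇒m<1+n (ℕ.n<1+n _))
                   (sym (trans (cong toℕ eq) (trans (toℕ-inject₁ _) (toℕ-inject₁ j′))))

sum-next : ∀ {n} (f : Fin (suc n) → Bool) → sum (λ i → f (next i)) ≡ sum f
sum-next {n} f = begin
  sum (λ i → f (next i))                                      ≡⟨ sum-init-last (λ i → f (next i)) ⟩
  sum (λ i → f (next (inject₁ i))) xor f (next (fromℕ n))     ≡⟨ cong₂ _xor_ (sum-cong-≗ λ i → cong f (next-inject₁ i)) (cong f (next-last n)) ⟩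
  sum (λ i → f (suc i)) xor f zero                            ≡⟨ xor-comm _ (f zero) ⟩
  sum f                                                       ∎
  where open ≡-Reasoning

-- Summed once around the cycle, every `h i` occurs twice and cancels modulo 2.
sum-circular : ∀ {n} (f h : Fin (suc n) → Bool) → (∀ i → f (next i) ≡ h i xor h (next i)) →
               sum f ≡ false
sum-circular f h eq = begin
  sum f                               ≡⟨ sum-next f ⟨
  sum (λ i → f (next i))              ≡⟨ sum-cong-≗ eq ⟩
  sum (λ i → h i xor h (next i))      ≡⟨ ∑-distrib-+ h (λ i → h (next i)) ⟩
  sum h xor sum (λ i → h (next i))    ≡⟨ cong (sum h xor_) (sum-next h) ⟩
  sum h xor sum h                     ≡⟨ xor-same (sum h) ⟩
  false                               ∎
  where open ≡-Reasoning

-- Converse of `walk-tabulate`: recovers the single steps of a marked boundary, the closing one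
-- included.
walk-steps : ∀ {A : Set} {R : A → A → Set} {z : A} k (f : Fin (suc k) → A) →
             All (uncurry R) (zip (tabulate f) (tabulate (f ∘ suc) ∷ʳ z)) →
             (∀ i → R (f (inject₁ i)) (f (suc i))) × R (f (fromℕ k)) z
walk-steps zero f (r ∷ []) = (λ ()) , r
walk-steps {R = R} (suc k) f (r ∷ rs) with walk-steps {R = R} k (f ∘ suc) rs
... | steps , last = (λ { zero → r ; (suc i) → steps i }) , last

-- From a winning plan to a strategy, on any board.

module Strategies (B : Board) (adj? : Decidable (Board.Adj B)) where
  open Board B
  open Game B

  _≟ᵃ_ : DecidableEquality Arrow
  _≟ᵃ_ = ≡-dec _≟_ _≟_

  open DecMembership _≟ᵃ_ using (_∈?_) public

  legal? : Decidable Legal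
  legal? p (u , v) =
    adj? u v ×-dec ¬? ((u , v) ∈? p) ×-dec ¬? ((v , u) ∈? p) ×-dec
    all? (λ w → ¬? (all? (λ x → adj? x w →-dec ((x , w) ∈? q))) ×-dec
                ¬? (all? (λ x → adj? w x →-dec ((w , x) ∈? q))))
    where
    q : Position
    q = (u , v) ∷ p

  someLegal? : ∀ p → Dec (∃ (Legal p))
  someLegal? p = map′ (λ { (u , v , l) → (u , v) , l })
                      (λ { ((u , v) , l) → u , v , l })
                      (any? (λ u → any? (λ v → legal? p (u , v))))

  hasCycleCell? : ∀ p → Dec (HasCycleCell p)
  hasCycleCell? p =
    Any.any? (λ κ → All.all? (_∈? p) (closedWalk κ) ⊎-dec
                    All.all? (λ e → swap e ∈? p) (closedWalk κ)) cells

  module _ (W : Player) (Inv : Position → Set) where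

    -- A winning plan for W, up to the positions in Inv, from which W is
    -- meant to win whatever both players do.
    data Secure : Position → Set where
      won    : ∀ {m p} → HasCycleCell (m ∷ p) → toMove p ≡ W → Secure (m ∷ p)
      safe   : ∀ {p} → Inv p → Secure p
      answer : ∀ {p} → ¬ HasCycleCell p → toMove p ≡ W →
               ∀ m → Legal p m → Secure (m ∷ p) → Secure p
      await  : ∀ {p} → ¬ HasCycleCell p → toMove p ≢ W → ∃ (Legal p) →
               (∀ m → Legal p m → Secure (m ∷ p)) → Secure p

    module _ (inv-step : ∀ {m p} → Inv p → Legal p m → Inv (m ∷ p))
             (inv-over : ∀ {p} → Inv p → Over p → WonBy W p)
             (root : Secure []) (default : Arrow) where

      private
        -- `nothing` stands for moves that the plan does not foresee; by `child-just` none occurs in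
        -- a play that follows the strategy.
        child : ∀ {p} → Secure p → ∀ m → Maybe (Secure (m ∷ p))
        child (won _ _) m = nothing
        child {p} (safe i) m with legal? p m
        ... | yes l = just (safe (inv-step i l))
        ... | no  _ = nothing
        child (answer _ _ m′ _ s) m with m ≟ᵃ m′
        ... | yes refl = just s
        ... | no  _    = nothing
        child {p} (await _ _ _ f) m with legal? p m
        ... | yes l = just (f m l)
        ... | no  _ = nothing

        -- A position carries its whole history, so the current node of the plan is found by
        -- replaying the moves from the root.
        plan : ∀ p → Maybe (Secure p)
        plan []      = just root
        plan (m ∷ p) = plan p >>= λ s → child s m

        -- From a safe position every legal move is good, so any one found is taken. `default`
        -- appears only where W owes no move.
        choose : ∀ {p} → Secure p → Arrow
        choose (won _ _)        = default
        choose {p} (safe _) with someLegal? p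
        ... | yes (m , _) = m
        ... | no  _       = default
        choose (answer _ _ m _ _) = m
        choose (await _ _ _ _)  = default

        σ : Strategy
        σ p = maybe′ choose default (plan p)

        σ-choose : ∀ {p s} → plan p ≡ just s → σ p ≡ choose s
        σ-choose = cong (maybe′ choose default)

        child-just : ∀ {p} (s : Secure p) {m} → ¬ HasCycleCell p → Legal p m →
                     (toMove p ≡ W → m ≡ choose s) → ∃ λ t → child s m ≡ just t
        child-just (won cyc _) ¬cyc l own = contradiction cyc ¬cyc
        child-just {p} (safe i) {m} ¬cyc l own with legal? p m
        ... | yes _ = _ , refl
        ... | no ¬l = contradiction l ¬l
        child-just (answer _ turn m′ _ _) {m} ¬cyc l own with m ≟ᵃ m′
        ... | yes refl = _ , refl
        ... | no  ≢    = contradiction (own turn) ≢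
        child-just {p} (await _ _ _ _) {m} ¬cyc l own with legal? p m
        ... | yes _ = _ , refl
        ... | no ¬l = contradiction l ¬l

        plan-just : ∀ {p} → Reachable W σ p → ∃ λ s → plan p ≡ just s
        plan-just start = root , refl
        plan-just (move {m} {p} r ¬cyc l own) with plan-just r
        ... | s , eq with child-just s ¬cyc l (λ turn → trans (own turn) (σ-choose eq))
        ... | t , eq′ = t , trans (cong (_>>= λ s → child s m) eq) eq′

        choose-legal : ∀ {p} (s : Secure p) → ¬ Over p → toMove p ≡ W → Legal p (choose s)
        choose-legal (won cyc _) ¬over turn = contradiction (inj₁ cyc) ¬over
        choose-legal {p} (safe _) ¬over turn with someLegal? p
        ... | yes (_ , l) = l
        ... | no  none    = contradiction (inj₂ (λ m l → none (m , l))) ¬over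
        choose-legal (answer _ _ _ l _) ¬over turn = l
        choose-legal (await _ turn′ _ _) ¬over turn = contradiction turn turn′

        over-won : ∀ {p} → Secure p → Over p → WonBy W p
        over-won (won cyc turn) over = by-cycle cyc turn
        over-won (safe i) over = inv-over i over
        over-won (answer ¬cyc _ _ _ _) (inj₁ cyc) = contradiction cyc ¬cyc
        over-won (answer _ _ m l _) (inj₂ none) = contradiction l (none m)
        over-won (await ¬cyc _ _ _) (inj₁ cyc) = contradiction cyc ¬cyc
        over-won (await _ _ (m , l) _) (inj₂ none) = contradiction l (none m)

      secure⇒winning : ∃ (Winning W)
      secure⇒winning = σ , λ p r → winningAt p (plan-just r)
        where
        winningAt : ∀ p → (∃ λ s → plan p ≡ just s) →
          (¬ Over p → toMove p ≡ W → Legal p (σ p)) × (Over p → WonBy W p)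
        winningAt p (s , eq) =
          (λ ¬over turn → subst (Legal p) (sym (σ-choose eq)) (choose-legal s ¬over turn))
          , over-won s

-- Orientation of arrows and legality, on any board.

module Moves (B : Board) (adj? : Decidable (Board.Adj B)) where
  open Board B
  open Game B
  open Strategies B adj?

  -- Reversing all arrows (d = false) exchanges sinks and sources and preserves
  -- legality, so one argument written with d covers both orientations.
  arr : Bool → Vertex → Vertex → Arrow
  arr true  u v = u , v
  arr false u v = v , u

  Marked : Bool → Position → Vertex → Vertex → Set
  Marked d p u v = arr d u v ∈ p

  Balanced : Position → Set
  Balanced p = ∀ w → ¬ Sink p w × ¬ Source p w

  -- Unlike `Reachable`, this follows no strategy and does not stop at a cycle cell.
  data History : Position → Set where
    []  : History []
    _∷_ : ∀ {m p} → Legal p m → History p → History (m ∷ p)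

  arr-injective : ∀ d {u v u′ v′} → arr d u v ≡ arr d u′ v′ → u ≡ u′ × v ≡ v′
  arr-injective true  refl = refl , refl
  arr-injective false refl = refl , refl

  exclusive : ∀ {p u v} → History p → (u , v) ∈ p → (v , u) ∉ p
  exclusive {u = u} ((adj , _) ∷ h) (here refl) (here refl) = adj-irr u adj
  exclusive ((_ , _ , ∉p , _) ∷ h) (here refl) (there x)    = ∉p x
  exclusive ((_ , _ , ∉p , _) ∷ h) (there x)   (here refl)  = ∉p x
  exclusive (_ ∷ h) (there x) (there y) = exclusive h x y

  marked-exclusive : ∀ d {p u v} → History p → Marked d p u v → ¬ Marked d p v u
  marked-exclusive true  h = exclusive h
  marked-exclusive false h = exclusive h

  -- On the empty board neighbours matter, since an isolated vertex is vacuously a sink; later the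
  -- legality of the last move suffices.
  history-balanced : (∀ v → ∃ λ u → Adj u v) → ∀ {p} → History p → Balanced p
  history-balanced nbr [] w with nbr w
  ... | u , adj = (λ s → contradiction (s u adj) λ ()) , (λ s → contradiction (s u (adj-sym adj)) λ ())
  history-balanced nbr ((_ , _ , _ , bal) ∷ h) = bal

  no-sink : ∀ d {p} → Balanced p → ∀ v → ¬ (∀ u → Adj u v → Marked d p u v)
  no-sink true  bal v s = proj₁ (bal v) s
  no-sink false bal v s = proj₂ (bal v) (λ u adj → s u (adj-sym adj))

  no-source : ∀ d {p} → Balanced p → ∀ v → ¬ (∀ u → Adj v u → Marked d p v u)
  no-source true  bal v s = proj₂ (bal v) s
  no-source false bal v s = proj₁ (bal v) (λ u adj → s u (adj-sym adj))

  marked-old : ∀ d {p u v u′ v′} → ¬ (u′ ≡ u × v′ ≡ v) →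
               Marked d (arr d u v ∷ p) u′ v′ → Marked d p u′ v′
  marked-old d ≢ (here eq) = contradiction (arr-injective d eq) ≢
  marked-old d ≢ (there x) = x

  unmarked : ∀ d {m p u v} → m ≢ arr d u v → ¬ Marked d p u v → ¬ Marked d (m ∷ p) u v
  unmarked d ≢ ∉p (here eq) = ≢ (sym eq)
  unmarked d ≢ ∉p (there x) = ∉p x

  -- The new arrow can only make `u` a source or `v` a sink; any other sink or source would already
  -- be present in `p`.
  legal-arr : ∀ d {p u v} → Balanced p → Adj u v → ¬ Marked d p u v → ¬ Marked d p v u →
              ¬ (∀ w → Adj u w → w ≢ v → Marked d p u w) →
              ¬ (∀ w → Adj w v → w ≢ u → Marked d p w v) →
              Legal p (arr d u v)
  legal-arr d {p} {u} {v} bal adj uv vu ¬source ¬sink = assemble d adj uv vu no-sink′ no-source′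
    where
    no-sink′ : ∀ w → ¬ (∀ x → Adj x w → Marked d (arr d u v ∷ p) x w)
    no-sink′ w s with w ≟ v
    ... | yes refl = ¬sink λ x a x≢u → marked-old d (x≢u ∘ proj₁) (s x a)
    ... | no  w≢v  = no-sink d bal w λ x a → marked-old d (w≢v ∘ proj₂) (s x a)
    no-source′ : ∀ w → ¬ (∀ x → Adj w x → Marked d (arr d u v ∷ p) w x)
    no-source′ w s with w ≟ u
    ... | yes refl = ¬source λ x a x≢v → marked-old d (x≢v ∘ proj₂) (s x a)
    ... | no  w≢u  = no-source d bal w λ x a → marked-old d (w≢u ∘ proj₁) (s x a)
    assemble : ∀ d → Adj u v → ¬ Marked d p u v → ¬ Marked d p v u →
               (∀ w → ¬ (∀ x → Adj x w → Marked d (arr d u v ∷ p) x w)) →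
               (∀ w → ¬ (∀ x → Adj w x → Marked d (arr d u v ∷ p) w x)) →
               Legal p (arr d u v)
    assemble true  adj uv vu sk sr = adj , uv , vu , λ w → sk w , sr w
    assemble false adj uv vu sk sr = adj-sym adj , uv , vu , λ w →
      (λ s → sr w λ x a → s x (adj-sym a)) , (λ s → sk w λ x a → s x (adj-sym a))

  marked? : ∀ d p u v → Dec (Marked d p u v)
  marked? d p u v = arr d u v ∈? p

  -- Contrapositive of `legal-arr`, with the two obstructions decided by finite search.
  blocked : ∀ d {p u v} → Balanced p → NoLegalMove p → Adj u v →
            ¬ Marked d p u v → ¬ Marked d p v u →
            (∀ w → Adj u w → w ≢ v → Marked d p u w) ⊎
            (∀ w → Adj w v → w ≢ u → Marked d p w v)
  blocked d {p} {u} {v} bal none adj uv vu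
    with all? (λ w → adj? u w →-dec (¬? (w ≟ v) →-dec marked? d p u w))
       | all? (λ w → adj? w v →-dec (¬? (w ≟ u) →-dec marked? d p w v))
  ... | yes source | _        = inj₁ source
  ... | no  _      | yes sink = inj₂ sink
  ... | no ¬source | no ¬sink =
    contradiction (legal-arr d bal adj uv vu ¬source ¬sink) (none _)

-- The two-cell board and its edges.

module Analysis (k : ℕ) (3≤n : 3 ≤ 3 + k) where

  board : Board
  board = twoCellBoard (3 + k) 3≤n

  open Board board
  open Game board

  a b c : Vertex
  a = zero
  b = suc zero
  c = fromℕ (3 + k)

  adj? : Decidable Adj
  adj? zero    zero    = no λ ()
  adj? zero    (suc j) = (j ≟ _) ⊎-dec (j ≟ _)
  adj? (suc i) zero    = (i ≟ _) ⊎-dec (i ≟ _)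
  adj? (suc i) (suc j) = cycleNext? i j ⊎-dec cycleNext? j i
    where
    cycleNext? : ∀ {n} (i j : Fin n) → Dec (CycleNext i j)
    cycleNext? i j = (_ ℕ.≟ _) ⊎-dec ((_ ℕ.≟ _) ×-dec (_ ℕ.≟ _))

  open Strategies board adj?
  open Moves board adj?

  adj-next : ∀ i → Adj i (next i)
  adj-next i with view i
  ... | ‵fromℕ          = inj₂ refl
  ... | ‵inj₁ {i = j} _ = TwoCell.adj-step (2 + k) j

  adj-bc : Adj b c
  adj-bc = inj₂ (inj₂ (cong suc (toℕ-fromℕ (2 + k)) , refl))

  neighbour : ∀ v → ∃ λ u → Adj u v
  neighbour v = next v , adj-sym {v} (adj-next v)

  data AdjView (u v : Vertex) : Set where
    forward  : v ≡ next u → AdjView u v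
    backward : u ≡ next v → AdjView u v
    chord    : u ≡ b → v ≡ c → AdjView u v
    chord⁻¹  : u ≡ c → v ≡ b → AdjView u v

  adjView : ∀ {u v} → Adj u v → AdjView u v
  adjView {zero} {suc _} (inj₁ refl) = forward refl
  adjView {zero} {suc _} (inj₂ refl) = backward (sym (next-last _))
  adjView {suc _} {zero} (inj₁ refl) = backward refl
  adjView {suc _} {zero} (inj₂ refl) = forward (sym (next-last _))
  adjView {suc _} {suc _} (inj₁ (inj₁ e)) = forward (sym (next-step (cong suc e)))
  adjView {suc _} {suc _} (inj₂ (inj₁ e)) = backward (sym (next-step (cong suc e)))
  adjView {suc i} {suc j} (inj₁ (inj₂ (e , f))) =
    chord⁻¹ (toℕ-injective (trans e (cong suc (sym (toℕ-fromℕ (2 + k))))))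
            (toℕ-injective (cong suc f))
  adjView {suc i} {suc j} (inj₂ (inj₂ (e , f))) =
    chord (toℕ-injective (cong suc f))
          (toℕ-injective (trans e (cong suc (sym (toℕ-fromℕ (2 + k))))))

  -- Lists each of the n + 2 edges once, in one orientation, for counting: first the chord bc, then
  -- the boundary of the long cell.
  ends : Fin (5 + k) → Arrow
  ends zero    = b , c
  ends (suc i) = i , next i

  adj-ends : ∀ {u v} → Adj u v → ∃ λ e → (u , v) ≡ ends e ⊎ (v , u) ≡ ends e
  adj-ends {u} {v} adj with adjView {u} {v} adj
  ... | forward refl      = suc u , inj₁ refl
  ... | backward refl     = suc v , inj₂ refl
  ... | chord refl refl   = zero , inj₁ refl
  ... | chord⁻¹ refl refl = zero , inj₂ refl

  ends-injective : ∀ e e′ → ends e ≡ ends e′ → e ≡ e′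
  ends-injective zero zero eq = refl
  ends-injective zero (suc i) eq with cong proj₁ eq
  ... | refl with cong proj₂ eq
  ... | ()
  ends-injective (suc i) zero eq with cong proj₁ eq
  ... | refl with cong proj₂ eq
  ... | ()
  ends-injective (suc i) (suc j) eq = cong suc (cong proj₁ eq)

  c-next : next c ≡ a
  c-next = next-last (3 + k)

  -- Two reversed edges of the long cell would force `next (next i)` to be `i`; an edge equal to the
  -- reversed chord fails because `next c` is `a`.
  ends-swap : ∀ e e′ → ends e ≢ swap (ends e′)
  ends-swap zero zero ()
  ends-swap zero (suc i) eq with cong proj₂ eq
  ... | refl with trans (cong proj₁ eq) c-next
  ... | ()
  ends-swap (suc i) zero eq with cong proj₁ eq
  ... | refl with trans (sym (cong proj₂ eq)) c-next
  ... | ()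
  ends-swap (suc i) (suc j) eq with cong proj₁ eq
  ... | refl = next²-irreflexive (cong proj₂ eq)

  -- Counting unmarked edges modulo 2.

  gap : Position → Arrow → Bool
  gap p (u , v) = not (does ((u , v) ∈? p) ∨ does ((v , u) ∈? p))

  cycleGap : Position → Vertex → Bool
  cycleGap p i = gap p (i , next i)

  gaps : Position → Bool
  gaps p = sum (λ e → gap p (ends e))

  parity : Position → Bool
  parity []      = false
  parity (_ ∷ p) = not (parity p)

  gap-marked : ∀ d p {u v} → Marked d p u v ⊎ Marked d p v u → gap p (u , v) ≡ false
  gap-marked d p {u} {v} m with (u , v) ∈? p | (v , u) ∈? p
  ... | yes _ | _     = refl
  ... | no  _ | yes _ = refl
  gap-marked true  p (inj₁ m) | no x | no y = contradiction m x
  gap-marked true  p (inj₂ m) | no x | no y = contradiction m y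
  gap-marked false p (inj₁ m) | no x | no y = contradiction m y
  gap-marked false p (inj₂ m) | no x | no y = contradiction m x

  gap-unmarked : ∀ d p {u v} → ¬ Marked d p u v → ¬ Marked d p v u → gap p (u , v) ≡ true
  gap-unmarked true  p {u} {v} x y rewrite dec-false ((u , v) ∈? p) x | dec-false ((v , u) ∈? p) y = refl
  gap-unmarked false p {u} {v} x y rewrite dec-false ((u , v) ∈? p) y | dec-false ((v , u) ∈? p) x = refl

  gap-other : ∀ m p {u v} → (u , v) ≢ m → (v , u) ≢ m → gap (m ∷ p) (u , v) ≡ gap p (u , v)
  gap-other m p {u} {v} ≢₁ ≢₂ = by-cases ((u , v) ∈? p) ((v , u) ∈? p)
    where
    same : ∀ {x} → gap (m ∷ p) (u , v) ≡ x → gap p (u , v) ≡ x →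
           gap (m ∷ p) (u , v) ≡ gap p (u , v)
    same eq eq′ = trans eq (sym eq′)
    by-cases : Dec ((u , v) ∈ p) → Dec ((v , u) ∈ p) →
               gap (m ∷ p) (u , v) ≡ gap p (u , v)
    by-cases (yes x) _ = same (gap-marked true (m ∷ p) (inj₁ (there x)))
                              (gap-marked true p (inj₁ x))
    by-cases _ (yes y) = same (gap-marked true (m ∷ p) (inj₂ (there y)))
                              (gap-marked true p (inj₂ y))
    by-cases (no ¬x) (no ¬y) =
      same (gap-unmarked true (m ∷ p) (unmarked true (≢₁ ∘ sym) ¬x)
                                      (unmarked true (≢₂ ∘ sym) ¬y))
           (gap-unmarked true p ¬x ¬y)

  -- The move fills one listed edge, along or against its listed orientation; `ends-injective` and
  -- `ends-swap` keep all other indices unaffected.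
  gaps-move : ∀ {m p} → Legal p m → gaps (m ∷ p) ≡ not (gaps p)
  gaps-move {u , v} {p} (adj , uv , vu , _) with adj-ends {u} {v} adj
  ... | e , inj₁ refl = sum-toggle {f = λ e → gap ((u , v) ∷ p) (ends e)} {λ e → gap p (ends e)} e
    (trans (gap-marked true ((u , v) ∷ p) (inj₁ (here refl)))
           (cong not (sym (gap-unmarked true p uv vu))))
    λ e′ ≢ → gap-other (u , v) p (≢ ∘ ends-injective e′ e)
                       (ends-swap e e′ ∘ sym)
  ... | e , inj₂ refl = sum-toggle {f = λ e → gap ((u , v) ∷ p) (ends e)} {λ e → gap p (ends e)} e
    (trans (gap-marked true ((u , v) ∷ p) (inj₂ (here refl)))
           (cong not (sym (gap-unmarked true p vu uv))))
    λ e′ ≢ → gap-other (u , v) p (ends-swap e′ e)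
                       (≢ ∘ ends-injective e′ e ∘ cong swap)

  -- Modulo 2: the moves made and the unmarked edges add up to n + 2.
  parity-gaps : ∀ {p} → History p → parity p xor gaps p ≡ odd (3 + k)
  parity-gaps [] = trans (sum-true (5 + k)) (not-involutive _)
  parity-gaps (_∷_ {m} {p} l h) = trans (lemma (parity p) (gaps-move l)) (parity-gaps h)
    where
    lemma : ∀ x {y z} → y ≡ not z → not x xor y ≡ x xor z
    lemma true  {z = z} refl = refl
    lemma false {z = z} refl = not-involutive z

  -- The triangle can no longer be completed, and only the very last edge can
  -- complete the long cell.
  record Decided (d : Bool) (p : Position) : Set where
    constructor decided
    field
      bc-marked : Marked d p b c
      killed    : Marked d p b a ⊎ Marked d p a c

  -- Decided positions: directions of the arrows around the long cell.

  module Parity {d p} (h : History p) (dec : Decided d p) where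
    open Decided dec renaming (bc-marked to bc)

    R : Vertex → Vertex → Set
    R = Marked d p

    R? : ∀ u v → Dec (R u v)
    R? = marked? d p

    excl : ∀ {u v} → R u v → ¬ R v u
    excl = marked-exclusive d h

    bal : Balanced p
    bal = history-balanced neighbour h

    -- Away from b and c the two given edges are all the edges at the vertex; at c the third edge is
    -- bc, which points in as well.
    sink-at : ∀ i → R i (next i) → R (next (next i)) (next i) →
              next i ≢ b → ⊥
    sink-at i x y j≢b = no-sink d bal (next i) into
      where
      into : ∀ u → Adj u (next i) → R u (next i)
      into u adj with adjView {u} {next i} adj
      ... | forward eq        = subst (λ u → R u (next i)) (next-injective eq) x
      ... | backward refl     = y
      ... | chord refl eq     = subst (R b) (sym eq) bc
      ... | chord⁻¹ refl eq   = contradiction eq j≢b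

    source-at : ∀ i → R (next i) i → R (next i) (next (next i)) →
                next i ≢ c → ⊥
    source-at i x y j≢c = no-source d bal (next i) out
      where
      out : ∀ u → Adj (next i) u → R (next i) u
      out u adj with adjView {next i} {u} adj
      ... | forward refl      = y
      ... | backward eq       = subst (R (next i)) (next-injective eq) x
      ... | chord eq refl     = subst (λ j → R j c) (sym eq) bc
      ... | chord⁻¹ eq refl   = contradiction eq j≢c

    -- If b → a is marked, the edge is taken; if a → c is marked, a → b would make `a` a source.
    ¬ab : ¬ R a b
    ¬ab ab with killed
    ... | inj₁ ba = excl ab ba
    ... | inj₂ ac = no-source d bal a out
      where
      out : ∀ u → Adj a u → R a u
      out (suc _) (inj₁ refl) = ab
      out (suc _) (inj₂ refl) = ac

    ¬ca : ¬ R c a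
    ¬ca ca with killed
    ... | inj₂ ac = excl ca ac
    ... | inj₁ ba = no-sink d bal a into
      where
      into : ∀ u → Adj u a → R u a
      into (suc _) (inj₁ refl) = ba
      into (suc _) (inj₂ refl) = ca

    -- The case left open by `sink-at` is the vertex b, where a clash would need a → b.
    no-clash : ∀ i → R i (next i) → ¬ R (next (next i)) (next i)
    no-clash i x y with next i ≟ b
    ... | no  j≢b = sink-at i x y j≢b
    ... | yes j≡b with next-injective {j = a} j≡b
    ... | refl = ¬ab x

    no-split : ∀ i → R (next i) i → ¬ R (next i) (next (next i))
    no-split i x y with next i ≟ c
    ... | no  j≢c = source-at i x y j≢c
    ... | yes j≡c = ¬ca (subst (λ v → R v a) j≡c
                      (subst (R (next i)) (trans (cong next j≡c) c-next) y))

    cycle-gaps : sum (cycleGap p) ≡ false → gaps p ≡ false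
    cycle-gaps eq = trans (cong (_xor sum (cycleGap p))
                                (gap-marked d p (inj₁ bc))) eq

    -- The direction in which the marked cycle edges pass through next i; in a
    -- stuck position it flips across an edge exactly when the edge is unmarked.
    flow : Vertex → Bool
    flow i = does (R? i (next i)) ∨
             (not (does (R? (next i) i)) ∧ does (R? (next i) (next (next i))))

    -- Each of the two arrows for the edge is blocked at one end. They are not blocked at the same
    -- end, as the neighbouring edge there would carry both directions; so both ends are obstructed,
    -- both outward or both inward.
    blocked-next : NoLegalMove p → ∀ i → let j = next i; l = next j in
                   ¬ R j l → ¬ R l j → (R j i × R l (next l)) ⊎ (R i j × R (next l) l)
    blocked-next none i jl lj
      with blocked d bal none (adj-next (next i)) jl lj
         | blocked d bal none (adj-sym {next i} (adj-next (next i))) lj jl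
    ... | inj₁ out | inj₁ out′ = inj₁
      ( out i (adj-sym {i} (adj-next i)) (next²-irreflexive ∘ sym)
      , out′ _ (adj-next _) next²-irreflexive )
    ... | inj₂ into | inj₂ into′ = inj₂
      ( into′ i (adj-next i) (next²-irreflexive ∘ sym)
      , into _ (adj-sym {next (next i)} (adj-next _)) next²-irreflexive )
    ... | inj₁ out | inj₂ into′ =
      contradiction (into′ i (adj-next i) (next²-irreflexive ∘ sym))
        (excl (out i (adj-sym {i} (adj-next i)) (next²-irreflexive ∘ sym)))
    ... | inj₂ into | inj₁ out′ =
      contradiction (into _ (adj-sym {next (next i)} (adj-next _)) next²-irreflexive)
        (excl (out′ _ (adj-next _) next²-irreflexive))

    -- At a marked edge the preceding edge agrees by `no-clash` and `no-split`, or is unmarked and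
    -- borrows its flow from this one. Across an unmarked edge `blocked-next` gives opposite
    -- directions.
    flow-next : NoLegalMove p → ∀ i →
                cycleGap p (next i) ≡ flow i xor flow (next i)
    flow-next none i with R? (next i) (next (next i)) | R? (next (next i)) (next i)
    ... | yes jl | _ with R? i (next i) | R? (next i) i
    ...   | yes _ | _      = gap-marked d p (inj₁ jl)
    ...   | no  _ | no _   = gap-marked d p (inj₁ jl)
    ...   | no  _ | yes ji = contradiction jl (no-split i ji)
    flow-next none i | no _ | yes lj with R? i (next i) | R? (next i) i
    ...   | yes ij | _    = contradiction lj (no-clash i ij)
    ...   | no _ | yes _  = gap-marked d p (inj₂ lj)
    ...   | no _ | no _   = gap-marked d p (inj₂ lj)
    flow-next none i | no jl | no lj with blocked-next none i jl lj
    ...   | inj₁ (ji , lm)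
      rewrite dec-false (R? i (next i)) (excl ji) | dec-true (R? (next i) i) ji
            | dec-true (R? (next (next i)) (next (next (next i)))) lm = gap-unmarked d p jl lj
    ...   | inj₂ (ij , ml)
      rewrite dec-true (R? i (next i)) ij
            | dec-false (R? (next (next i)) (next (next (next i)))) (excl ml) = gap-unmarked d p jl lj

    stuck-even : NoLegalMove p → gaps p ≡ false
    stuck-even none = cycle-gaps (sum-circular (cycleGap p) flow (flow-next none))

    complete-even : (∀ i → R i (next i) ⊎ R (next i) i) → gaps p ≡ false
    complete-even full = cycle-gaps
      (trans (sum-cong-≗ {y = λ _ → false} (λ i → gap-marked d p (full i))) (sum-false (4 + k)))

  -- Completed cells and the outcome of decided positions.

  opposite : ∀ d d′ {p} → d′ ≡ d ⊎ (∀ {u v} → Marked d′ p u v → Marked d p v u)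
  opposite true  true  = inj₁ refl
  opposite false false = inj₁ refl
  opposite true  false = inj₂ λ x → x
  opposite false true  = inj₂ λ x → x

  around : ∀ d {p} → (∀ i → Marked d p (inject₁ i) (suc i)) → Marked d p c a →
           ∀ i → Marked d p i (next i)
  around d steps ca i with view i
  ... | ‵fromℕ = ca
  ... | ‵inj₁ {i = j} _ = steps j

  -- Traversed as listed, both cells run through a → b and c → a; only the rest of the boundary
  -- tells them apart.
  cell-marks : ∀ {p} → HasCycleCell p →
               ∃ λ d → Marked d p a b × Marked d p c a ×
                       (Marked d p b c ⊎ (∀ i → Marked d p i (next i)))
  cell-marks (here (inj₁ (ab ∷ bc ∷ ca ∷ []))) = true , ab , ca , inj₁ bc
  cell-marks (here (inj₂ (ab ∷ bc ∷ ca ∷ []))) = false , ab , ca , inj₁ bc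
  cell-marks {p} (there (here (inj₁ cell)))
    with walk-steps {R = Marked true p} (3 + k) (λ i → i) cell
  ... | steps , ca = true , steps zero , ca , inj₂ (around true steps ca)
  cell-marks {p} (there (here (inj₂ cell)))
    with walk-steps {R = Marked false p} (3 + k) (λ i → i) cell
  ... | steps , ca = false , steps zero , ca , inj₂ (around false steps ca)

  -- A cell cycling in direction `d` would need c → a. In the reverse direction the triangle
  -- conflicts with bc, so the long cell is complete and no edge is unmarked.
  over-even : ∀ {d p} → History p → Decided d p → Over p → gaps p ≡ false
  over-even h dec (inj₂ none) = Parity.stuck-even h dec none
  over-even {d} {p} h dec (inj₁ cyc) with cell-marks cyc
  ... | d′ , ab , ca , rest with opposite d d′ {p}
  ...   | inj₁ refl = contradiction ca (Parity.¬ca h dec)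
  ...   | inj₂ rev with rest
  ...     | inj₁ bc   = contradiction (rev bc) (marked-exclusive d h (Decided.bc-marked dec))
  ...     | inj₂ full = Parity.complete-even h dec (λ i → inj₂ (rev (full i)))

  turn : Bool → Player
  turn false = player1
  turn true  = player2

  toMove-parity : ∀ p → toMove p ≡ turn (parity p)
  toMove-parity []      = refl
  toMove-parity (_ ∷ p) with parity p | toMove-parity p
  ... | true  | eq = cong opponent eq
  ... | false | eq = cong opponent eq

  -- The negation gives the parity of n + 1, the number of moves before move n + 2.
  W : Player
  W = turn (not (odd (3 + k)))

  Safe : Position → Set
  Safe p = History p × ∃ λ d → Decided d p

  safe-step : ∀ {m p} → Safe p → Legal p m → Safe (m ∷ p)
  safe-step (h , d , decided bc (inj₁ ba)) l = l ∷ h , d , decided (there bc) (inj₁ (there ba))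
  safe-step (h , d , decided bc (inj₂ ac)) l = l ∷ h , d , decided (there bc) (inj₂ (there ac))

  last-move : ∀ {m p} → Safe (m ∷ p) → Over (m ∷ p) → toMove p ≡ W
  last-move {m} {p} (h , d , dec) over = trans (toMove-parity p) (cong turn (begin
    parity p                                    ≡⟨ not-involutive (parity p) ⟨
    not (parity (m ∷ p))                        ≡⟨ cong not (xor-identityʳ (parity (m ∷ p))) ⟨
    not (parity (m ∷ p) xor false)              ≡⟨ cong (λ x → not (parity (m ∷ p) xor x)) (over-even h dec over) ⟨
    not (parity (m ∷ p) xor gaps (m ∷ p))       ≡⟨ cong not (parity-gaps h) ⟩
    not (odd (3 + k))                           ∎))
    where open ≡-Reasoning

  safe-over : ∀ {p} → Safe p → Over p → WonBy W p
  safe-over {[]} (_ , true  , decided () _) over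
  safe-over {[]} (_ , false , decided () _) over
  safe-over {m ∷ p} s over with hasCycleCell? (m ∷ p)
  ... | yes cyc = by-cycle cyc (last-move s over)
  safe-over {m ∷ p} s (inj₁ cyc)  | no ¬cyc = contradiction cyc ¬cyc
  safe-over {m ∷ p} s (inj₂ none) | no ¬cyc = by-last-move ¬cyc none (last-move s (inj₂ none))

  -- Winning plans from the opening.

  Plan : Position → Set
  Plan = Secure W Safe

  Free : Position → Set
  Free p = ∀ d u → ¬ Marked d p a u × ¬ Marked d p u a

  free-[] : Free []
  free-[] true  u = (λ ()) , (λ ())
  free-[] false u = (λ ()) , (λ ())

  free-∷ : ∀ d {p u v} → u ≢ a → v ≢ a → Free p → Free (arr d u v ∷ p)
  free-∷ true  u≢a v≢a f true  x = (λ { (here refl) → u≢a refl ; (there m) → proj₁ (f true x) m })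
                                 , (λ { (here refl) → v≢a refl ; (there m) → proj₂ (f true x) m })
  free-∷ true  u≢a v≢a f false x = (λ { (here refl) → v≢a refl ; (there m) → proj₁ (f false x) m })
                                 , (λ { (here refl) → u≢a refl ; (there m) → proj₂ (f false x) m })
  free-∷ false u≢a v≢a f true  x = (λ { (here refl) → v≢a refl ; (there m) → proj₁ (f true x) m })
                                 , (λ { (here refl) → u≢a refl ; (there m) → proj₂ (f true x) m })
  free-∷ false u≢a v≢a f false x = (λ { (here refl) → u≢a refl ; (there m) → proj₁ (f false x) m })
                                 , (λ { (here refl) → v≢a refl ; (there m) → proj₂ (f false x) m })

  free-¬cycle : ∀ {p} → Free p → ¬ HasCycleCell p
  free-¬cycle f cyc with cell-marks cyc
  ... | d , ab , _ = proj₁ (f d b) ab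

  -- Every cycle cell uses both edges at `a`, and one move marks only one of them.
  free-¬cycle-∷ : ∀ {m p} → Free p → ¬ HasCycleCell (m ∷ p)
  free-¬cycle-∷ f cyc with cell-marks cyc
  ... | d , there ab , _             = proj₁ (f d b) ab
  ... | d , here _   , there ca , _  = proj₂ (f d c) ca
  ... | d , here eq  , here eq′ , _ with arr-injective d (trans eq (sym eq′))
  ...   | () , _

  triangle-cycle : ∀ d {p} → Marked d p a b → Marked d p b c → Marked d p c a → HasCycleCell p
  triangle-cycle true  ab bc ca = here (inj₁ (ab ∷ bc ∷ ca ∷ []))
  triangle-cycle false ab bc ca = here (inj₂ (ab ∷ bc ∷ ca ∷ []))

  -- The neighbours of b and c on the outer path; for n = 3 they coincide.
  b⁺ c⁻ : Vertex
  b⁺ = suc (suc zero)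
  c⁻ = inject₁ (fromℕ (2 + k))

  adj-c⁻c : Adj c⁻ c
  adj-c⁻c = TwoCell.adj-step (2 + k) (fromℕ (2 + k))

  legal-move : ∀ d {p u v} → History p → Adj u v → ¬ Marked d p u v → ¬ Marked d p v u →
               ∀ w → Adj u w → w ≢ v → ¬ Marked d p u w →
               ∀ x → Adj x v → x ≢ u → ¬ Marked d p x v → Legal p (arr d u v)
  legal-move d {u = u} {v} h adj uv vu w uw w≢v ¬uw x xv x≢u ¬xv =
    legal-arr d {u = u} {v} (history-balanced neighbour h) adj uv vu
      (λ all → ¬uw (all w uw w≢v)) (λ all → ¬xv (all x xv x≢u))

  apartˡ : ∀ d {u v u′ v′} → u ≢ u′ → arr d u v ≢ arr d u′ v′
  apartˡ d u≢u′ eq = u≢u′ (proj₁ (arr-injective d eq))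

  apartʳ : ∀ d {u v u′ v′} → v ≢ v′ → arr d u v ≢ arr d u′ v′
  apartʳ d v≢v′ eq = v≢v′ (proj₂ (arr-injective d eq))

  oriented : ∀ d m → ∃ λ u → ∃ λ v → m ≡ arr d u v
  oriented true  (u , v) = u , v , refl
  oriented false (u , v) = v , u , refl

  legal-adj : ∀ d {p u v} → Legal p (arr d u v) → Adj u v
  legal-adj true        l = proj₁ l
  legal-adj false {v = v} l = adj-sym {v} (proj₁ l)

  -- W threatens to spoil the triangle at b or at c; the opponent can parry only
  -- one of the two in a single move.
  record Opened (d : Bool) (p : Position) : Set where
    field
      history  : History p
      bc-marked : Marked d p b c
      free     : Free p
      bb⁺-free : ¬ Marked d p b b⁺
      c⁻c-free : ¬ Marked d p c⁻ c

  legal-ba : ∀ d {p} → History p → Free p → ¬ Marked d p b b⁺ → Legal p (arr d b a)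
  legal-ba d h f bb⁺ = legal-move d h (inj₁ refl) (proj₂ (f d b)) (proj₁ (f d b))
    b⁺ (adj-next b) (λ ()) bb⁺ c (inj₂ refl) (λ ()) (proj₂ (f d c))

  legal-ac : ∀ d {p} → History p → Free p → ¬ Marked d p c⁻ c → Legal p (arr d a c)
  legal-ac d h f c⁻c = legal-move d h (inj₂ refl) (proj₁ (f d c)) (proj₂ (f d c))
    b (inj₁ refl) (λ ()) (proj₁ (f d b)) c⁻ adj-c⁻c (λ ()) c⁻c

  opened-plan : ∀ {d p} → Opened d p → opponent (toMove p) ≡ W → Plan p
  opened-plan {d} {p} o ours = await (free-¬cycle free) (opponent-≢ ours)
    -- The opponent is not stuck: the move that W threatens is legal for either player.
    (_ , legal-ba d history free bb⁺-free) reply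
    where
    open Opened o

    opponent-≢ : ∀ {P Q} → opponent P ≡ Q → P ≢ Q
    opponent-≢ {player1} () refl
    opponent-≢ {player2} () refl

    killed : ∀ {p} → History p → Marked d p b c → Marked d p b a ⊎ Marked d p a c → Plan p
    killed h bc kill = safe (h , d , decided bc kill)

    respond : ∀ u v → Legal p (arr d u v) → Adj u v → Plan (arr d u v ∷ p)
    -- After a → b the arrow c → a completes the triangle; the clause for c → a below is its mirror
    -- image.
    respond zero (suc _) l (inj₁ refl) =
      answer (free-¬cycle-∷ free) ours (arr d c a)
        (legal-move d (l ∷ history) (inj₂ refl)
          (unmarked d (apartˡ d λ ()) (proj₂ (free d c)))
          (unmarked d (apartʳ d λ ()) (proj₁ (free d c)))
          b (adj-sym {b} {c} adj-bc) (λ ())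
          (unmarked d (apartˡ d λ ()) (marked-exclusive d history bc-marked))
          b (inj₁ refl) (λ ()) (unmarked d (apartˡ d λ ()) (proj₂ (free d b))))
        (won (triangle-cycle d (there (here refl)) (there (there bc-marked)) (here refl)) ours)
    respond zero (suc _) l (inj₂ refl) = killed (l ∷ history) (there bc-marked) (inj₂ (here refl))
    respond (suc _) zero l (inj₁ refl) = killed (l ∷ history) (there bc-marked) (inj₁ (here refl))
    respond (suc _) zero l (inj₂ refl) =
      answer (free-¬cycle-∷ free) ours (arr d a b)
        (legal-move d (l ∷ history) (inj₁ refl)
          (unmarked d (apartˡ d λ ()) (proj₁ (free d b)))
          (unmarked d (apartˡ d λ ()) (proj₂ (free d b)))
          c (inj₂ refl) (λ ()) (unmarked d (apartˡ d λ ()) (proj₁ (free d c)))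
          c (adj-sym {b} {c} adj-bc) (λ ())
          (unmarked d (apartʳ d λ ()) (marked-exclusive d history bc-marked)))
        (won (triangle-cycle d (here refl) (there (there bc-marked)) (there (here refl))) ours)
    -- Among arrows avoiding `a`, only b → b⁺ makes b → a illegal; it differs from c⁻ → c and so
    -- leaves a → c legal.
    respond (suc i) (suc j) l _ with arr d (suc i) (suc j) ≟ᵃ arr d b b⁺
    ... | no y≢ = answer (free-¬cycle-∷ free) ours (arr d b a) l′
                   (killed (l′ ∷ l ∷ history) (there (there bc-marked)) (inj₁ (here refl)))
      where
      l′ : Legal (arr d (suc i) (suc j) ∷ p) (arr d b a)
      l′ = legal-ba d (l ∷ history) (free-∷ d (λ ()) (λ ()) free) (unmarked d y≢ bb⁺-free)
    ... | yes eq = answer (free-¬cycle-∷ free) ours (arr d a c) l′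
                   (killed (l′ ∷ l ∷ history) (there (there bc-marked)) (inj₂ (here refl)))
      where
      l′ : Legal (arr d (suc i) (suc j) ∷ p) (arr d a c)
      l′ = legal-ac d (l ∷ history) (free-∷ d (λ ()) (λ ()) free)
             (unmarked d (apartˡ d (λ ()) ∘ trans (sym eq)) c⁻c-free)

    reply : ∀ m → Legal p m → Plan (m ∷ p)
    reply m l with oriented d m
    ... | u , v , refl = respond u v l (legal-adj d {u = u} {v} l)

  unmarked-[] : ∀ d {u v} → ¬ Marked d [] u v
  unmarked-[] true  ()
  unmarked-[] false ()

  -- Besides bc each end has two edges; either of them prevents the source or sink, so the caller
  -- names the convenient one.
  legal-bc : ∀ d {p} → History p → ¬ Marked d p b c → ¬ Marked d p c b →
             ¬ Marked d p b a ⊎ ¬ Marked d p b b⁺ → ¬ Marked d p a c ⊎ ¬ Marked d p c⁻ c →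
             Legal p (arr d b c)
  legal-bc d h bc cb source sink =
    legal-arr d {u = b} {c} (history-balanced neighbour h) adj-bc bc cb (¬source source) (¬sink sink)
    where
    ¬source : ¬ Marked d _ b a ⊎ ¬ Marked d _ b b⁺ → ¬ (∀ w → Adj b w → w ≢ c → Marked d _ b w)
    ¬source (inj₁ ¬ba) all = ¬ba (all a (inj₁ refl) λ ())
    ¬source (inj₂ ¬bb⁺) all = ¬bb⁺ (all b⁺ (adj-next b) λ ())
    ¬sink : ¬ Marked d _ a c ⊎ ¬ Marked d _ c⁻ c → ¬ (∀ w → Adj w c → w ≢ b → Marked d _ w c)
    ¬sink (inj₁ ¬ac) all = ¬ac (all a (inj₂ refl) λ ())
    ¬sink (inj₂ ¬c⁻c) all = ¬c⁻c (all c⁻ adj-c⁻c λ ())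

  odd-plan : odd (3 + k) ≡ true → Plan []
  odd-plan eq = answer (free-¬cycle free-[]) ours (b , c) l (opened-plan {d = true} record
    { history   = l ∷ []
    ; bc-marked = here refl
    ; free      = free-∷ true (λ ()) (λ ()) free-[]
    ; bb⁺-free  = unmarked true (apartʳ true λ ()) λ ()
    ; c⁻c-free  = unmarked true (apartˡ true λ ()) λ ()
    } ours)
    where
    l : Legal [] (b , c)
    l = legal-bc true [] (λ ()) (λ ()) (inj₁ λ ()) (inj₁ λ ())
    ours : player1 ≡ W
    ours = cong (turn ∘ not) (sym eq)

  -- `d` is chosen so that the arrow runs from `next i` back to `i`. At a and c this gives b → a and
  -- a → c, which decide the position once b → c is added; elsewhere it is neither b → b⁺ nor c⁻ →
  -- c, so both threats survive.
  adj-oriented : ∀ {u v} → Adj u v →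
                 ∃ λ d → (u , v) ≡ arr d b c ⊎ ∃ λ i → (u , v) ≡ arr d (next i) i
  adj-oriented {u} {v} adj with adjView {u} {v} adj
  ... | forward refl      = false , inj₂ (u , refl)
  ... | backward refl     = true , inj₂ (v , refl)
  ... | chord refl refl   = true , inj₁ refl
  ... | chord⁻¹ refl refl = false , inj₁ refl

  even-plan : odd (3 + k) ≡ false → Plan []
  even-plan eq = await (free-¬cycle free-[]) theirs
    ((b , c) , legal-bc true [] (λ ()) (λ ()) (inj₁ λ ()) (inj₁ λ ())) reply
    where
    ours : player2 ≡ W
    ours = cong (turn ∘ not) (sym eq)

    theirs : player1 ≢ W
    theirs e with trans e (sym ours)
    ... | ()

    reply-on-cycle : ∀ d i → Legal [] (arr d (next i) i) → Plan (arr d (next i) i ∷ [])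
    reply-on-cycle d i l with i ≟ a | i ≟ c
    ... | yes refl | _ = answer (free-¬cycle-∷ free-[]) ours (arr d b c) l′
      (safe (l′ ∷ l ∷ [] , d , decided (here refl) (inj₁ (there (here refl)))))
      where
      l′ : Legal (arr d b a ∷ []) (arr d b c)
      l′ = legal-bc d (l ∷ [])
             (unmarked d (apartʳ d λ ()) (unmarked-[] d)) (unmarked d (apartˡ d λ ()) (unmarked-[] d))
             (inj₂ (unmarked d (apartʳ d λ ()) (unmarked-[] d)))
             (inj₁ (unmarked d (apartˡ d λ ()) (unmarked-[] d)))
    ... | no _ | yes refl rewrite c-next = answer (free-¬cycle-∷ free-[]) ours (arr d b c) l′
      (safe (l′ ∷ l ∷ [] , d , decided (here refl) (inj₂ (there (here refl)))))
      where
      l′ : Legal (arr d a c ∷ []) (arr d b c)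
      l′ = legal-bc d (l ∷ [])
             (unmarked d (apartˡ d λ ()) (unmarked-[] d)) (unmarked d (apartˡ d λ ()) (unmarked-[] d))
             (inj₁ (unmarked d (apartˡ d λ ()) (unmarked-[] d)))
             (inj₂ (unmarked d (apartˡ d λ ()) (unmarked-[] d)))
    ... | no i≢a | no i≢c = answer (free-¬cycle-∷ free-[]) ours (arr d b c) l′ (opened-plan record
      { history   = l′ ∷ l ∷ []
      ; bc-marked = here refl
      ; free      = free-∷ d (λ ()) (λ ()) (free-∷ d next≢a i≢a free-[])
      ; bb⁺-free  = unmarked d (apartʳ d λ ()) (unmarked d (apartˡ d next≢b) (unmarked-[] d))
      ; c⁻c-free  = unmarked d (apartˡ d λ ()) (unmarked d (apartʳ d i≢c) (unmarked-[] d))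
      } ours)
      where
      next≢a : next i ≢ a
      next≢a e = i≢c (next-injective (trans e (sym c-next)))
      next≢b : next i ≢ b
      next≢b e = i≢a (next-injective {j = a} e)
      -- Rules out that the arrow already marks c → b: the successor of b is b⁺, which is not c as n
      -- is at least 3.
      b≢c⁺ : ∀ {j : Vertex} → j ≡ b → next j ≢ c
      b≢c⁺ refl ()
      l′ : Legal (arr d (next i) i ∷ []) (arr d b c)
      l′ = legal-bc d (l ∷ [])
             (unmarked d (apartˡ d next≢b) (unmarked-[] d))
             (unmarked d (λ e → b≢c⁺ (proj₂ (arr-injective d e)) (proj₁ (arr-injective d e))) (unmarked-[] d))
             (inj₁ (unmarked d (apartˡ d next≢b) (unmarked-[] d)))
             (inj₁ (unmarked d (apartˡ d next≢a) (unmarked-[] d)))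

    reply-to-bc : ∀ d → Legal [] (arr d b c) → Plan (arr d b c ∷ [])
    reply-to-bc d l = answer (free-¬cycle-∷ free-[]) ours (arr d b a) l′
      (safe (l′ ∷ l ∷ [] , d , decided (there (here refl)) (inj₁ (here refl))))
      where
      l′ : Legal (arr d b c ∷ []) (arr d b a)
      l′ = legal-ba d (l ∷ []) (free-∷ d (λ ()) (λ ()) free-[])
             (unmarked d (apartʳ d λ ()) (unmarked-[] d))

    reply : ∀ m → Legal [] m → Plan (m ∷ [])
    reply (u , v) l with adj-oriented {u} {v} (proj₁ l)
    ... | d , inj₁ refl = reply-to-bc d l
    ... | d , inj₂ (i , refl) = reply-on-cycle d i l

theorem4p5 : (n : ℕ) (3≤n : 3 ≤ n) →
    (¬ (2 ∣ n) → HasWinningStrategy (twoCellBoard n 3≤n) player1) ×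
    (2 ∣ n → HasWinningStrategy (twoCellBoard n 3≤n) player2)
theorem4p5 (suc zero)          (s≤s ())
theorem4p5 (suc (suc zero))    (s≤s (s≤s ()))
theorem4p5 (suc (suc (suc k))) 3≤n = player1-wins , player2-wins ∘ 2∣⇒even
  where
  open Analysis k 3≤n

  wins : Plan [] → HasWinningStrategy board W
  -- The default arrow `(b , c)` only fills positions where no legal move is owed.
  wins plan = Strategies.secure⇒winning board adj? W Safe safe-step safe-over plan (b , c)

  player2-wins : odd (3 + k) ≡ false → HasWinningStrategy board player2
  player2-wins eq =
    subst (HasWinningStrategy board) (cong (turn ∘ not) eq) (wins (even-plan eq))

  player1-wins : ¬ (2 ∣ 3 + k) → HasWinningStrategy board player1
  player1-wins ¬2∣n with odd (3 + k) in eq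
  ... | true  = subst (HasWinningStrategy board) (cong (turn ∘ not) eq) (wins (odd-plan eq))
  ... | false = contradiction (even⇒2∣ (3 + k) eq) ¬2∣n
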